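{- For every fixed integer $k \ge 2$ there is a constant $c_1(k) > 0$ such that the almost balanced ordered biclique covering number $f(n,k)$ of order $k$ of the complete graph $K_n$ satisfies $$f(n,k) \;\ge\; (1+o(1)) \cdot c_1(k) \cdot n^{\frac{1}{\lceil k/2\rceil + 1}} ,$$ where $o(1)$ denotes a quantity tending to $0$ as $n \to \infty$ with $k$ fixed.
   Context: A biclique $B=(U,W)$ in the complete graph $K_n$ is a complete bipartite subgraph given by an ordered pair of disjoint vertex sets: a first class $U$ and a second class $W$. It contains (covers) the edge $\{u,v\}$ if one of $u,v$ lies in $U$ and the other lies in $W$. For a positive integer $k$, an almost balanced ordered biclique covering of order $k$ of $K_n$ is a finite collection of bicliques $(U_1,W_1),\dots,(U_d,W_d)$ such that: (i) every edge of $K_n$ is contained in at least one and at most $k$ of the bicliques; (ii) for every edge $\{u,v\}$, the number of indices $i$ with $u\in U_i$, $v\in W_i$ and the number of indices $i$ with $v\in U_i$, $u\in W_i$ differ by at most one. The number $d$ is the size of the collection, and $f(n,k)$ is the minimum size of an almost balanced ordered biclique covering of order $k$ of $K_n$. -}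

module Defs where

open import Axiom.UniquenessOfIdentityProofs.WithK using (uip)
open import Data.Bool.Base using (true; false; _∧_; _∨_; if_then_else_)
open import Data.Bool.Properties using (∧-zeroʳ; ∨-identityʳ) renaming (_≟_ to _≟ᵇ_)
open import Data.Fin.Base using (Fin; zero; suc)
import Data.Fin.Properties as Fin
open import Data.Fin.Subset using (Subset; inside; outside; _∈_; _∩_; ⊥; ⊤)
open import Data.Fin.Subset.Properties using (_∈?_; ∈⊤; ∉⊥; ∩-zeroˡ; anySubset?)
open import Data.Integer.Base using (+_)
open import Data.Nat.Base using (ℕ; zero; suc; _≤_; z≤n; s≤s; NonZero; >-nonZero⁻¹; ∣_-_∣)
open import Data.Nat.Properties using (_≤?_; ≤-refl; ≤-trans; ≤-reflexive)
open import Data.Product.Base using (∃; _×_; _,_; proj₁; proj₂)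
open import Data.Rational.Base as ℚ using (ℚ; 0ℚ)
open import Data.Sum.Base using (_⊎_)
open import Data.Vec.Base using (Vec; []; _∷_; map; count)
import Data.Vec.Properties as Vec
open import Function.Base using (_∘_; id)
open import Relation.Binary.PropositionalEquality using (_≡_; _≢_; refl; sym; trans; cong; cong₂; subst)
open import Relation.Nullary using (Dec; yes; no; does; contradiction)
open import Relation.Nullary.Decidable using (map′; _×-dec_; _⊎-dec_; _→-dec_; ¬?; dec-true; dec-false)
open import Relation.Unary using (Decidable)

open import Algebra.Definitions.RawSemiring ℚ.+-*-rawSemiring using (_^_)

private variable
  n d : ℕ

-- Either class may be empty; this does not affect the minimum size of a
-- covering, since a biclique with an empty class contains no edge.
record Biclique (n : ℕ) : Set where
  constructor biclique
  field
    first    : Subset n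
    second   : Subset n
    disjoint : first ∩ second ≡ ⊥

open Biclique public

Directed : Fin n → Fin n → Biclique n → Set
Directed u v B = u ∈ first B × v ∈ second B

directed? : (u v : Fin n) → Decidable (Directed u v)
directed? u v B = (u ∈? first B) ×-dec (v ∈? second B)

Contains : Fin n → Fin n → Biclique n → Set
Contains u v B = Directed u v B ⊎ Directed v u B

contains? : (u v : Fin n) → Decidable (Contains u v)
contains? u v B = directed? u v B ⊎-dec directed? v u B

-- The edges of Kₙ are the pairs of distinct vertices in Fin n.
IsAlmostBalancedCovering : (k : ℕ) → Vec (Biclique n) d → Set
IsAlmostBalancedCovering {n} k Bs = (u v : Fin n) → u ≢ v →
  (1 ≤ count (contains? u v) Bs × count (contains? u v) Bs ≤ k) ×
  ∣ count (directed? u v) Bs - count (directed? v u) Bs ∣ ≤ 1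

HasCovering : (n k d : ℕ) → Set
HasCovering n k d = ∃ λ (Bs : Vec (Biclique n) d) → IsAlmostBalancedCovering k Bs

IsMinimum : (ℕ → Set) → ℕ → Set
IsMinimum P m = P m × (∀ j → P j → m ≤ j)

private

  minimum : {P : ℕ → Set} → Decidable P → ∀ m → P m → ∃ (IsMinimum P)
  minimum P? zero p = zero , p , λ _ _ → z≤n
  minimum P? (suc m) p with P? zero
  ... | yes p₀ = zero , p₀ , λ _ _ → z≤n
  ... | no ¬p₀ = let l , pl , least = minimum (P? ∘ suc) m p in
    suc l , pl , λ where
      zero    q → contradiction q ¬p₀
      (suc j) q → s≤s (least j q)

  anyBiclique? : {P : Biclique n → Set} → Decidable P → Dec (∃ P)
  anyBiclique? {n} {P} P? = map′
    (λ (U , W , e , p) → biclique U W e , p)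
    (λ (biclique U W e , p) → U , W , e , p)
    (anySubset? {P = λ U → ∃ λ W → ∃ λ e → P (biclique U W e)}
      λ U → anySubset? λ W → inner U W)
    where
    inner : ∀ U W → Dec (∃ λ e → P (biclique U W e))
    inner U W with Vec.≡-dec _≟ᵇ_ (U ∩ W) ⊥
    ... | no ¬e = no (¬e ∘ proj₁)
    ... | yes e = map′ (e ,_)
      (λ (e′ , p) → subst (P ∘ biclique U W) (uip e′ e) p)
      (P? (biclique U W e))

  anyVec? : ∀ d {P : Vec (Biclique n) d → Set} → Decidable P → Dec (∃ P)
  anyVec? zero P? = map′ ([] ,_) (λ where ([] , p) → p) (P? [])
  anyVec? (suc d) {P} P? = map′
    (λ (B , Bs , p) → B ∷ Bs , p)
    (λ where (B ∷ Bs , p) → B , Bs , p)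
    (anyBiclique? {P = λ B → ∃ λ Bs → P (B ∷ Bs)} λ B → anyVec? d λ Bs → P? (B ∷ Bs))

  isAlmostBalancedCovering? : ∀ k → Decidable (IsAlmostBalancedCovering {n} {d} k)
  isAlmostBalancedCovering? k Bs = Fin.all? λ u → Fin.all? λ v → ¬? (u Fin.≟ v) →-dec
    (((1 ≤? _) ×-dec (_ ≤? k)) ×-dec (_ ≤? 1))

  hasCovering? : ∀ n k → Decidable (HasCovering n k)
  hasCovering? n k d = anyVec? d (isAlmostBalancedCovering? k)

  shift : Biclique n → Biclique (suc n)
  shift (biclique U W e) = biclique (outside ∷ U) (outside ∷ W) (cong (outside ∷_) e)

  star : ∀ n → Biclique (suc n)
  star n = biclique (inside ∷ ⊥) (outside ∷ ⊤) (cong (outside ∷_) (∩-zeroˡ ⊤))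

  stars : ∀ n → Vec (Biclique n) n
  stars zero    = []
  stars (suc n) = star n ∷ map shift (stars n)

  count-shift : {P : Biclique (suc n) → Set} {Q : Biclique n → Set}
                (P? : Decidable P) (Q? : Decidable Q) →
                (∀ B → does (P? (shift B)) ≡ does (Q? B)) →
                (Bs : Vec (Biclique n) d) → count P? (map shift Bs) ≡ count Q? Bs
  count-shift P? Q? eq [] = refl
  count-shift P? Q? eq (B ∷ Bs) =
    cong₂ (λ b m → (if b then suc else id) m) (eq B) (count-shift P? Q? eq Bs)

  count-none : {P : Biclique n → Set} (P? : Decidable P) (f : Biclique d → Biclique n) →
               (∀ B → does (P? (f B)) ≡ false) →
               ∀ {l} (Bs : Vec (Biclique d) l) → count P? (map f Bs) ≡ 0
  count-none P? f eq [] = refl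
  count-none P? f eq (B ∷ Bs) rewrite eq B = count-none P? f eq Bs

  ExactlyOnce : Vec (Biclique n) d → Fin n → Fin n → Set
  ExactlyOnce Bs u v =
    count (contains? u v) Bs ≡ 1 ×
    ∣ count (directed? u v) Bs - count (directed? v u) Bs ∣ ≤ 1

  exactlyOnce : ∀ (Bs : Vec (Biclique n) d) u v {i j} → count (contains? u v) Bs ≡ 1 →
                count (directed? u v) Bs ≡ i → count (directed? v u) Bs ≡ j →
                ∣ i - j ∣ ≤ 1 → ExactlyOnce Bs u v
  exactlyOnce _ _ _ once refl refl balanced = once , balanced

  count-stars : ∀ {n} {P : Biclique (suc n) → Set} (P? : Decidable P) {b m} →
                does (P? (star n)) ≡ b → count P? (map shift (stars n)) ≡ m →
                count P? (stars (suc n)) ≡ (if b then suc else id) m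
  count-stars P? = cong₂ (λ b m → (if b then suc else id) m)

  v∈⊤ : ∀ (v : Fin n) → does (v ∈? ⊤) ≡ true
  v∈⊤ v = dec-true (v ∈? ⊤) ∈⊤

  v∉⊥ : ∀ (v : Fin n) → does (v ∈? ⊥) ≡ false
  v∉⊥ v = dec-false (v ∈? ⊥) ∉⊥

  stars-exactlyOnce : ∀ n (u v : Fin n) → u ≢ v → ExactlyOnce (stars n) u v
  stars-exactlyOnce (suc n) zero zero u≢v = contradiction refl u≢v
  stars-exactlyOnce (suc n) zero (suc v) _ = exactlyOnce (stars (suc n)) zero (suc v)
    (count-stars (contains? zero (suc v))
      (cong₂ _∨_ (v∈⊤ v) refl)
      (count-none (contains? zero (suc v)) shift (λ B → ∧-zeroʳ _) (stars n)))
    (count-stars (directed? zero (suc v)) (v∈⊤ v)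
      (count-none (directed? zero (suc v)) shift (λ B → refl) (stars n)))
    (count-stars (directed? (suc v) zero) (∧-zeroʳ _)
      (count-none (directed? (suc v) zero) shift (λ B → ∧-zeroʳ _) (stars n)))
    ≤-refl
  stars-exactlyOnce (suc n) (suc u) zero _ = exactlyOnce (stars (suc n)) (suc u) zero
    (count-stars (contains? (suc u) zero)
      (cong₂ _∨_ (∧-zeroʳ _) (v∈⊤ u))
      (count-none (contains? (suc u) zero) shift
        (λ B → trans (∨-identityʳ _) (∧-zeroʳ _)) (stars n)))
    (count-stars (directed? (suc u) zero) (∧-zeroʳ _)
      (count-none (directed? (suc u) zero) shift (λ B → ∧-zeroʳ _) (stars n)))
    (count-stars (directed? zero (suc u)) (v∈⊤ u)
      (count-none (directed? zero (suc u)) shift (λ B → refl) (stars n)))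
    ≤-refl
  stars-exactlyOnce (suc n) (suc u) (suc v) u≢v =
    let once , balanced = stars-exactlyOnce n u v (u≢v ∘ cong suc) in
    exactlyOnce (stars (suc n)) (suc u) (suc v)
    (count-stars (contains? (suc u) (suc v))
      (cong₂ _∨_ (cong (_∧ _) (v∉⊥ u)) (cong (_∧ _) (v∉⊥ v)))
      (trans (count-shift (contains? (suc u) (suc v)) (contains? u v) (λ B → refl) (stars n)) once))
    (count-stars (directed? (suc u) (suc v)) (cong (_∧ _) (v∉⊥ u))
      (count-shift (directed? (suc u) (suc v)) (directed? u v) (λ B → refl) (stars n)))
    (count-stars (directed? (suc v) (suc u)) (cong (_∧ _) (v∉⊥ v))
      (count-shift (directed? (suc v) (suc u)) (directed? v u) (λ B → refl) (stars n)))
    balanced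

  stars-covering : ∀ n k .{{_ : NonZero k}} → HasCovering n k n
  stars-covering n k = stars n , λ u v u≢v →
    let once , balanced = stars-exactlyOnce n u v u≢v in
    (≤-reflexive (sym once) , ≤-trans (≤-reflexive once) (>-nonZero⁻¹ k)) , balanced

f-minimum : ∀ n k .{{_ : NonZero k}} → ∃ (IsMinimum (HasCovering n k))
f-minimum n k = minimum (hasCovering? n k) n (stars-covering n k)

f : (n k : ℕ) .{{_ : NonZero k}} → ℕ
f n k = proj₁ (f-minimum n k)

f-isMinimum : ∀ n k .{{_ : NonZero k}} → IsMinimum (HasCovering n k) (f n k)
f-isMinimum n k = proj₂ (f-minimum n k)

ℕ→ℚ : ℕ → ℚ
ℕ→ℚ n = + n ℚ./ 1

-- x ≥ a · n ^[1/ m ]  says that x ≥ a · n^(1/m) in the reals, for x ≥ 0 and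
-- m ≥ 1: the real number n^(1/m) is the supremum of the rationals q ≥ 0 with
-- q^m ≤ n.  For negative a both inequalities hold trivially.
infix 4 _≥_·_^[1/_]
_≥_·_^[1/_] : ℚ → ℚ → ℕ → ℕ → Set
x ≥ a · n ^[1/ m ] = ∀ q → 0ℚ ℚ.≤ q → q ^ m ℚ.≤ ℕ→ℚ n → a ℚ.* q ℚ.≤ x

TendsToZero : (ℕ → ℚ) → Set
TendsToZero ε = ∀ δ → 0ℚ ℚ.< δ → ∃ λ N → ∀ n → N ≤ n → ℚ.∣ ε n ∣ ℚ.< δ

{-# OPTIONS --safe #-}

-- For vertices u and v let a and b be the numbers of bicliques that contain
-- {u,v} directed from u to v and from v to u, and let m = ⌈k/2⌉.  On an edge,
-- 1 ≤ a + b ≤ k and |a − b| ≤ 1, so that a lies between 1 and m, unless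
-- (a , b) = (0 , 1).  Hence (1 + a − b) ∏_{1≤j≤m} (a − j) vanishes on every
-- edge, while its value for u = v, where a = b = 0, is ±m!.  The n × n matrix
-- of these values therefore has full rank.  For a covering of size d the
-- matrices of a and of b are sums of d outer products, so this rank is at most
-- (1 + 2d) (1 + d)^m ≤ (3d)^(m+1).
module Submission where

open import Defs
open import Data.Bool.Base using (if_then_else_)
open import Data.Fin.Base using (Fin; zero; punchIn)
open import Data.Fin.Properties using (any?; punchInᵢ≢i; punchIn-injective)
open import Data.Fin.Subset using (_∈_)
open import Data.Fin.Subset.Properties using (_∈?_; ∉⊥; x∈p∩q⁺)
open import Data.Integer.Base as ℤ using (ℤ; +_; 0ℤ; 1ℤ; -1ℤ)
import Data.Integer.Properties as ℤ
import Data.Integer.Tactic.RingSolver as ℤ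
open import Data.Nat.Base as ℕ using (ℕ; zero; suc; _≤_; z≤n; s≤s; NonZero; ⌈_/2⌉; ⌊_/2⌋; ∣_-_∣)
import Data.Nat.Properties as ℕ
open import Data.Product.Base using (∃-syntax; _×_; _,_; proj₁)
open import Data.Rational.Base as ℚ using (ℚ; 0ℚ; 1ℚ; _<_; _+_; _*_)
import Data.Rational.Properties as ℚ
open import Data.Rational.Unnormalised.Base as ℚᵘ using (mkℚᵘ)
import Data.Rational.Unnormalised.Properties as ℚᵘ
open import Data.Sum.Base using (inj₁; inj₂; [_,_]′)
open import Data.Vec.Base using (Vec; []; _∷_; count)
open import Function.Base using (_∘_)
open import Relation.Binary.PropositionalEquality
open import Relation.Nullary using (¬_; Dec; yes; no; does; contradiction)
open import Relation.Nullary.Decidable using (¬?; decidable-stable)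

open import Algebra.Definitions.RawSemiring ℚ.+-*-rawSemiring using (_^_)

private variable
  A B A′ B′ : Set
  F G : A → B → ℤ
  n d r s : ℕ

-- Matrices as sums of outer products.

-- An upper bound witnessed by a decomposition: `p` and `q` may vanish, so `r` need not be the exact
-- rank. All vectors are integral, which keeps the later elimination free of fractions.
data Rank≤ {A B : Set} : ℕ → (A → B → ℤ) → Set where
  zero : ∀ {F} → (∀ u v → F u v ≡ 0ℤ) → Rank≤ zero F
  suc  : ∀ {r F G} (p : A → ℤ) (q : B → ℤ) → Rank≤ r G →
         (∀ u v → F u v ≡ p u ℤ.* q v ℤ.+ G u v) → Rank≤ (suc r) F

Rank≤-resp : (∀ u v → F u v ≡ G u v) → Rank≤ r F → Rank≤ r G
Rank≤-resp F≡G (zero eq)       = zero λ u v → trans (sym (F≡G u v)) (eq u v)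
Rank≤-resp F≡G (suc p q rk eq) = suc p q rk λ u v → trans (sym (F≡G u v)) (eq u v)

Rank≤-outer : (p : A → ℤ) (q : B → ℤ) → Rank≤ 1 (λ u v → p u ℤ.* q v)
Rank≤-outer p q = suc p q (zero λ _ _ → refl) λ u v → sym (ℤ.+-identityʳ _)

Rank≤-+ : Rank≤ r F → Rank≤ s G → Rank≤ (r ℕ.+ s) (λ u v → F u v ℤ.+ G u v)
Rank≤-+ {G = G} (zero eq) rk′ =
  Rank≤-resp (λ u v → sym (trans (cong (ℤ._+ G u v) (eq u v)) (ℤ.+-identityˡ _))) rk′
Rank≤-+ {G = G} (suc p q rk eq) rk′ = suc p q (Rank≤-+ rk rk′) λ u v →
  trans (cong (ℤ._+ G u v) (eq u v)) (ℤ.+-assoc (p u ℤ.* q v) _ _)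

-- A row operation changes only the left vector of each outer product. In the elimination `f` and
-- `h` skip the pivot row and column, while `g` is constantly the pivot row.
Rank≤-rowCombination : (α β : A′ → ℤ) (f g : A′ → A) (h : B′ → B) → Rank≤ r F →
  Rank≤ r (λ u v → α u ℤ.* F (f u) (h v) ℤ.+ β u ℤ.* F (g u) (h v))
Rank≤-rowCombination α β f g h (zero eq) = zero λ u v →
  trans (cong₂ (λ x y → α u ℤ.* x ℤ.+ β u ℤ.* y) (eq _ _) (eq _ _)) (lemma (α u) (β u))
  where
  lemma : ∀ a b → a ℤ.* 0ℤ ℤ.+ b ℤ.* 0ℤ ≡ 0ℤ
  lemma = ℤ.solve-∀
Rank≤-rowCombination α β f g h (suc p q rk eq) =
  suc (λ u → α u ℤ.* p (f u) ℤ.+ β u ℤ.* p (g u)) (q ∘ h)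
    (Rank≤-rowCombination α β f g h rk) λ u v →
  trans (cong₂ (λ x y → α u ℤ.* x ℤ.+ β u ℤ.* y) (eq _ _) (eq _ _)) (lemma (α u) (β u) _ _ _ _ _)
  where
  lemma : ∀ a b x y z X Y → a ℤ.* (x ℤ.* z ℤ.+ X) ℤ.+ b ℤ.* (y ℤ.* z ℤ.+ Y) ≡
                            (a ℤ.* x ℤ.+ b ℤ.* y) ℤ.* z ℤ.+ (a ℤ.* X ℤ.+ b ℤ.* Y)
  lemma = ℤ.solve-∀

-- The entrywise product of two outer products is again an outer product.
Rank≤-scale : (p : A → ℤ) (q : B → ℤ) → Rank≤ r F →
              Rank≤ r (λ u v → p u ℤ.* q v ℤ.* F u v)
Rank≤-scale p q (zero eq) = zero λ u v →
  trans (cong (p u ℤ.* q v ℤ.*_) (eq u v)) (ℤ.*-zeroʳ (p u ℤ.* q v))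
Rank≤-scale p q (suc p′ q′ rk eq) =
  suc (λ u → p u ℤ.* p′ u) (λ v → q v ℤ.* q′ v) (Rank≤-scale p q rk) λ u v →
  trans (cong (p u ℤ.* q v ℤ.*_) (eq u v)) (lemma (p u) (q v) _ _ _)
  where
  lemma : ∀ x y x′ y′ z → x ℤ.* y ℤ.* (x′ ℤ.* y′ ℤ.+ z) ≡
                          x ℤ.* x′ ℤ.* (y ℤ.* y′) ℤ.+ x ℤ.* y ℤ.* z
  lemma = ℤ.solve-∀

-- Expand the first factor into its `r` outer products; each rescales the second factor at no cost
-- in rank.
Rank≤-hadamard : Rank≤ r F → Rank≤ s G → Rank≤ (r ℕ.* s) (λ u v → F u v ℤ.* G u v)
Rank≤-hadamard {G = G} (zero eq) rk′ = zero λ u v → cong (ℤ._* G u v) (eq u v)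
Rank≤-hadamard {G = G} (suc p q rk eq) rk′ = Rank≤-resp
  (λ u v → sym (trans (cong (ℤ._* G u v) (eq u v)) (ℤ.*-distribʳ-+ (G u v) (p u ℤ.* q v) _)))
  (Rank≤-+ (Rank≤-scale p q rk′) (Rank≤-hadamard rk rk′))

-- Elimination with a pivot row i subtracts from the other rows multiples of
-- row i.  Away from column i row i is zero, so what remains of the matrix is
-- again diagonal.
diagonal⇒n≤r : {F : Fin n → Fin n → ℤ} → Rank≤ r F →
               (∀ u → F u u ≢ 0ℤ) → (∀ u v → u ≢ v → F u v ≡ 0ℤ) → n ≤ r
diagonal⇒n≤r {n = zero}  _ _ _ = z≤n
diagonal⇒n≤r {n = suc n} (zero eq) F≢0 _ = contradiction (eq zero zero) (F≢0 zero)
diagonal⇒n≤r {n = suc n} {F = F} (suc {G = G} p q rk eq) F≢0 F≡0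
  with any? (λ i → ¬? (p i ℤ.≟ 0ℤ))
... | no ¬pivot = ℕ.m≤n⇒m≤1+n (diagonal⇒n≤r rk
        (λ u → F≢0 u ∘ trans (F≡G u u))
        (λ u v → trans (sym (F≡G u v)) ∘ F≡0 u v))
  where
  p≡0 : ∀ u → p u ≡ 0ℤ
  p≡0 u = decidable-stable (p u ℤ.≟ 0ℤ) λ pu≢0 → ¬pivot (u , pu≢0)

  F≡G : ∀ u v → F u v ≡ G u v
  F≡G u v = trans (eq u v) (trans (cong (λ x → x ℤ.* q v ℤ.+ G u v) (p≡0 u)) (ℤ.+-identityˡ _))
-- Multiplication by `p i` replaces division. What remains is `p i` times `F` without row and column
-- `i`, and both bounds drop by one.
... | yes (i , pi≢0) = s≤s (diagonal⇒n≤r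
        (Rank≤-rowCombination (λ _ → p i) (λ u → ℤ.- p (punchIn i u))
          (punchIn i) (λ _ → i) (punchIn i) rk)
        (λ u → [ pi≢0 , F≢0 _ ]′ ∘ ℤ.i*j≡0⇒i≡0∨j≡0 (p i) ∘ trans (sym (minor u u)))
        (λ u v u≢v → trans (minor u v)
          (trans (cong (p i ℤ.*_) (F≡0 _ _ (u≢v ∘ punchIn-injective i u v))) (ℤ.*-zeroʳ (p i)))))
  where
  eliminate : ∀ a x z X Y → a ℤ.* X ℤ.+ ℤ.- x ℤ.* Y ≡
              a ℤ.* (x ℤ.* z ℤ.+ X) ℤ.+ ℤ.- x ℤ.* (a ℤ.* z ℤ.+ Y)
  eliminate = ℤ.solve-∀

  vanish : ∀ a x → a ℤ.+ ℤ.- x ℤ.* 0ℤ ≡ a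
  vanish = ℤ.solve-∀

  minor : ∀ u v →
    p i ℤ.* G (punchIn i u) (punchIn i v) ℤ.+ ℤ.- p (punchIn i u) ℤ.* G i (punchIn i v) ≡
    p i ℤ.* F (punchIn i u) (punchIn i v)
  minor u v = begin
    p i ℤ.* G u′ v′ ℤ.+ ℤ.- p u′ ℤ.* G i v′  ≡⟨ eliminate (p i) (p u′) (q v′) _ _ ⟩
    p i ℤ.* (p u′ ℤ.* q v′ ℤ.+ G u′ v′) ℤ.+ ℤ.- p u′ ℤ.* (p i ℤ.* q v′ ℤ.+ G i v′)
      ≡⟨ cong₂ (λ x y → p i ℤ.* x ℤ.+ ℤ.- p u′ ℤ.* y) (eq u′ v′) (eq i v′) ⟨
    p i ℤ.* F u′ v′ ℤ.+ ℤ.- p u′ ℤ.* F i v′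
      ≡⟨ cong (λ y → p i ℤ.* F u′ v′ ℤ.+ ℤ.- p u′ ℤ.* y) (F≡0 i v′ (punchInᵢ≢i i v ∘ sym)) ⟩
    p i ℤ.* F u′ v′ ℤ.+ ℤ.- p u′ ℤ.* 0ℤ      ≡⟨ vanish _ (p u′) ⟩
    p i ℤ.* F u′ v′                          ∎
    where
    open ≡-Reasoning
    u′ = punchIn i u
    v′ = punchIn i v

-- Matrices of directed counts.

indicator : {P : Set} → Dec P → ℤ
indicator P? = if does P? then 1ℤ else 0ℤ

count-directed-∷ : ∀ (u v : Fin n) B (Bs : Vec (Biclique n) d) →
  + count (directed? u v) (B ∷ Bs) ≡
  indicator (u ∈? first B) ℤ.* indicator (v ∈? second B) ℤ.+ + count (directed? u v) Bs
count-directed-∷ u v B Bs with u ∈? first B | v ∈? second B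
... | yes _ | yes _ = refl
... | yes _ | no _  = refl
... | no _  | yes _ = refl
... | no _  | no _  = refl

-- The pairs directed by one biclique form a rectangle, whose matrix is the outer product of the
-- indicators of the two classes.
Rank≤-count : (Bs : Vec (Biclique n) d) → Rank≤ d (λ u v → + count (directed? u v) Bs)
Rank≤-count []       = zero λ _ _ → refl
Rank≤-count (B ∷ Bs) = suc
  (λ u → indicator (u ∈? first B)) (λ v → indicator (v ∈? second B))
  (Rank≤-count Bs) λ u v → count-directed-∷ u v B Bs

Rank≤-transpose : Rank≤ r F → Rank≤ r (λ v u → F u v)
Rank≤-transpose (zero eq)       = zero λ v u → eq u v
Rank≤-transpose (suc p q rk eq) = suc q p (Rank≤-transpose rk) λ v u →
  trans (eq u v) (cong (ℤ._+ _) (ℤ.*-comm (p u) (q v)))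

disjoint-classes : ∀ (B : Biclique n) u → u ∈ first B → ¬ u ∈ second B
disjoint-classes B u u∈U u∈W = ∉⊥ (subst (u ∈_) (disjoint B) (x∈p∩q⁺ (u∈U , u∈W)))

-- As classes are disjoint, no biclique contains a pair in both directions, so nothing is counted
-- twice.
count-contains : ∀ (u v : Fin n) (Bs : Vec (Biclique n) d) →
  count (contains? u v) Bs ≡ count (directed? u v) Bs ℕ.+ count (directed? v u) Bs
count-contains u v [] = refl
count-contains u v (B ∷ Bs) with u ∈? first B | v ∈? second B | v ∈? first B | u ∈? second B
... | yes u∈U | _       | _       | yes u∈W = contradiction u∈W (disjoint-classes B u u∈U)
... | _       | yes v∈W | yes v∈U | _       = contradiction v∈W (disjoint-classes B v v∈U)
... | yes _   | yes _   | no _    | no _    = cong suc (count-contains u v Bs)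
... | no _    | no _    | yes _   | yes _   =
  trans (cong suc (count-contains u v Bs)) (sym (ℕ.+-suc _ _))
... | yes _   | no _    | yes _   | no _    = count-contains u v Bs
... | yes _   | no _    | no _    | no _    = count-contains u v Bs
... | no _    | yes _   | no _    | _       = count-contains u v Bs
... | no _    | no _    | yes _   | no _    = count-contains u v Bs
... | no _    | no _    | no _    | _       = count-contains u v Bs

-- Disjointness again; this sets the diagonal apart from the edges, where some count is positive.
count-loop : ∀ (u : Fin n) (Bs : Vec (Biclique n) d) → count (directed? u u) Bs ≡ 0
count-loop u [] = refl
count-loop u (B ∷ Bs) with u ∈? first B | u ∈? second B
... | yes u∈U | yes u∈W = contradiction u∈W (disjoint-classes B u u∈U)
... | yes _   | no _    = count-loop u Bs
... | no _    | _       = count-loop u Bs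

-- A polynomial vanishing on edges.

-- The product (x - 1)(x - 2)⋯(x - m), a falling factorial of x - 1.
∏[_-1…_] : ℤ → ℕ → ℤ
∏[ x -1… zero  ] = 1ℤ
∏[ x -1… suc m ] = (x ℤ.+ ℤ.- (+ suc m)) ℤ.* ∏[ x -1… m ]

∏-root : ∀ {x} m → 1 ≤ x → x ≤ m → ∏[ + x -1… m ] ≡ 0ℤ
∏-root {suc x} zero    _   ()
∏-root {x}     (suc m) 1≤x x≤1+m with ℕ.m≤n⇒m<n∨m≡n x≤1+m
... | inj₁ (s≤s x≤m) = trans
  (cong ((+ x ℤ.+ ℤ.- (+ suc m)) ℤ.*_) (∏-root m 1≤x x≤m)) (ℤ.*-zeroʳ (+ x ℤ.+ ℤ.- (+ suc m)))
... | inj₂ refl = cong (ℤ._* ∏[ + x -1… m ]) (ℤ.+-inverseʳ (+ x))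

∏-at-0 : ∀ m → ∏[ 0ℤ -1… m ] ≢ 0ℤ
∏-at-0 (suc m) eq with ℤ.i*j≡0⇒i≡0∨j≡0 (0ℤ ℤ.+ ℤ.- (+ suc m)) eq
-- The other case would make -(m + 1) zero, which computation refutes.
... | inj₂ eq′ = ∏-at-0 m eq′

-- Each factor adds a constant matrix, of rank at most one, to `F`; hence the base `suc r`.
Rank≤-∏ : ∀ m → Rank≤ r F → Rank≤ (suc r ℕ.^ m) (λ u v → ∏[ F u v -1… m ])
Rank≤-∏ zero    rk = Rank≤-outer (λ _ → 1ℤ) (λ _ → 1ℤ)
Rank≤-∏ {r = r} {F = F} (suc m) rk = Rank≤-hadamard
  (Rank≤-resp (λ u v → trans (cong (ℤ._+ F u v) (ℤ.*-identityˡ -j)) (ℤ.+-comm -j (F u v)))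
    (Rank≤-+ (Rank≤-outer (λ _ → 1ℤ) (λ _ → -j)) rk))
  (Rank≤-∏ m rk)
  where -j = ℤ.- (+ suc m)

-- The bracketing and `-1ℤ ℤ.* + b` make this agree by computation with the matrix decomposed in
-- `covering-bound`.
edgePolynomial : ℕ → ℕ → ℕ → ℤ
edgePolynomial m a b = (1ℤ ℤ.+ (+ a ℤ.+ -1ℤ ℤ.* + b)) ℤ.* ∏[ + a -1… m ]

edgePolynomial-0-0 : ∀ m → edgePolynomial m 0 0 ≢ 0ℤ
edgePolynomial-0-0 m = ∏-at-0 m ∘ trans (sym (ℤ.*-identityˡ _))

-- From a ≤ b + |a - b| follows 2a ≤ k + 1, and ⌈k/2⌉ unfolds to ⌊(k + 1)/2⌋.
balanced⇒≤⌈k/2⌉ : ∀ {k} a b → a ℕ.+ b ≤ k → ∣ a - b ∣ ≤ 1 → a ≤ ⌈ k /2⌉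
balanced⇒≤⌈k/2⌉ {k} a b a+b≤k ∣a-b∣≤1 = begin
  a                ≡⟨ ℕ.n≡⌊n+n/2⌋ a ⟩
  ⌊ a ℕ.+ a /2⌋    ≤⟨ ℕ.⌊n/2⌋-mono a+a≤1+k ⟩
  ⌈ k /2⌉          ∎
  where
  open ℕ.≤-Reasoning
  a+a≤1+k : a ℕ.+ a ≤ suc k
  a+a≤1+k = begin
    a ℕ.+ a                    ≤⟨ ℕ.+-monoʳ-≤ a (ℕ.m≤n+∣m-n∣ a b) ⟩
    a ℕ.+ (b ℕ.+ ∣ a - b ∣)    ≤⟨ ℕ.+-monoʳ-≤ a (ℕ.+-monoʳ-≤ b ∣a-b∣≤1) ⟩
    a ℕ.+ (b ℕ.+ 1)            ≡⟨ ℕ.+-assoc a b 1 ⟨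
    (a ℕ.+ b) ℕ.+ 1            ≡⟨ ℕ.+-comm _ 1 ⟩
    suc (a ℕ.+ b)              ≤⟨ s≤s a+b≤k ⟩
    suc k                      ∎

edgePolynomial-edge : ∀ {k} a b → 1 ≤ a ℕ.+ b → a ℕ.+ b ≤ k → ∣ a - b ∣ ≤ 1 →
                      edgePolynomial ⌈ k /2⌉ a b ≡ 0ℤ
-- For a = 0 balance leaves only b = 1, a root of the linear factor.
edgePolynomial-edge zero (suc zero) _ _ _ = refl
edgePolynomial-edge zero (suc (suc b)) _ _ (s≤s ())
edgePolynomial-edge {k} a@(suc _) b _ a+b≤k balanced =
  trans (cong (1+a-b ℤ.*_) (∏-root ⌈ k /2⌉ (s≤s z≤n) (balanced⇒≤⌈k/2⌉ a b a+b≤k balanced)))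
        (ℤ.*-zeroʳ 1+a-b)
  where 1+a-b = 1ℤ ℤ.+ (+ a ℤ.+ -1ℤ ℤ.* + b)

-- Bounding n by the size of a covering.

covering-bound : ∀ k → HasCovering n k d →
                 n ≤ suc (d ℕ.+ d) ℕ.* suc d ℕ.^ ⌈ k /2⌉
covering-bound k (Bs , covering) = diagonal⇒n≤r
  (Rank≤-hadamard
    (Rank≤-+ (Rank≤-outer (λ _ → 1ℤ) (λ _ → 1ℤ))
      (Rank≤-+ (Rank≤-count Bs)
        -- The counts b are the transpose of the counts a; the sign is absorbed as a scaling.
        (Rank≤-scale (λ _ → -1ℤ) (λ _ → 1ℤ) (Rank≤-transpose (Rank≤-count Bs)))))
    (Rank≤-∏ ⌈ k /2⌉ (Rank≤-count Bs)))
  (λ u → edgePolynomial-0-0 ⌈ k /2⌉ ∘ trans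
    (sym (cong₂ (edgePolynomial ⌈ k /2⌉) (count-loop u Bs) (count-loop u Bs))))
  (λ u v u≢v → let (1≤c , c≤k) , balanced = covering u v u≢v
                   c≡ = count-contains u v Bs in
    edgePolynomial-edge (count (directed? u v) Bs) (count (directed? v u) Bs)
      (subst (1 ≤_) c≡ 1≤c) (subst (_≤ k) c≡ c≤k) balanced)

-- For d ≥ 1 both 1 + 2d and 1 + d are at most 3d, which gives a pure power whose root can be taken.
covering-bound-power : ∀ k → 2 ≤ n → HasCovering n k d → n ≤ (3 ℕ.* d) ℕ.^ suc ⌈ k /2⌉
-- For d = 0 the rank bound reads n ≤ 1.
covering-bound-power {n = n} {d = zero} k 2≤n cov = contradiction
  (ℕ.≤-trans 2≤n (ℕ.≤-trans (covering-bound k cov) (ℕ.≤-reflexive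
    (trans (ℕ.*-identityˡ _) (ℕ.^-zeroˡ ⌈ k /2⌉)))))
  λ where (s≤s ())
covering-bound-power {n = n} {d = d@(suc _)} k _ cov = begin
  n                                                ≤⟨ covering-bound k cov ⟩
  suc (d ℕ.+ d) ℕ.* suc d ℕ.^ ⌈ k /2⌉              ≤⟨ ℕ.*-mono-≤ 1+2d≤3d (ℕ.^-monoˡ-≤ ⌈ k /2⌉ 1+d≤3d) ⟩
  (3 ℕ.* d) ℕ.* (3 ℕ.* d) ℕ.^ ⌈ k /2⌉              ∎
  where
  open ℕ.≤-Reasoning
  1+2d≤3d : suc (d ℕ.+ d) ≤ 3 ℕ.* d
  1+2d≤3d = ℕ.+-mono-≤ {1} {d} (s≤s z≤n) (ℕ.+-monoʳ-≤ d (ℕ.m≤m+n d 0))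

  1+d≤3d : suc d ≤ 3 ℕ.* d
  1+d≤3d = ℕ.≤-trans (s≤s (ℕ.m≤m+n d d)) 1+2d≤3d

-- Naturals and powers in the rationals.

-- `ℕ→ℚ` normalises by a gcd, whereas unnormalised fractions expose the numerator to direct
-- computation.
toℚᵘ-ℕ→ℚ : ∀ n → ℚ.toℚᵘ (ℕ→ℚ n) ℚᵘ.≃ mkℚᵘ (+ n) 0
toℚᵘ-ℕ→ℚ n = ℚ.toℚᵘ-fromℚᵘ (mkℚᵘ (+ n) 0)

ℕ→ℚ-mono-≤ : ∀ {m n} → m ≤ n → ℕ→ℚ m ℚ.≤ ℕ→ℚ n
ℕ→ℚ-mono-≤ {m} {n} m≤n = ℚ.toℚᵘ-cancel-≤ (begin
  ℚ.toℚᵘ (ℕ→ℚ m)  ≃⟨ toℚᵘ-ℕ→ℚ m ⟩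
  mkℚᵘ (+ m) 0    ≤⟨ ℚᵘ.*≤* (ℤ.*-monoʳ-≤-nonNeg 1ℤ (ℤ.+≤+ m≤n)) ⟩
  mkℚᵘ (+ n) 0    ≃⟨ toℚᵘ-ℕ→ℚ n ⟨
  ℚ.toℚᵘ (ℕ→ℚ n)  ∎)
  where open ℚᵘ.≤-Reasoning

ℕ→ℚ-homo-* : ∀ m n → ℕ→ℚ (m ℕ.* n) ≡ ℕ→ℚ m * ℕ→ℚ n
ℕ→ℚ-homo-* m n = ℚ.toℚᵘ-injective (begin-equality
  ℚ.toℚᵘ (ℕ→ℚ (m ℕ.* n))                ≃⟨ toℚᵘ-ℕ→ℚ (m ℕ.* n) ⟩
  mkℚᵘ (+ (m ℕ.* n)) 0                  ≡⟨ cong (λ i → mkℚᵘ i 0) (ℤ.pos-* m n) ⟩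
  mkℚᵘ (+ m) 0 ℚᵘ.* mkℚᵘ (+ n) 0        ≃⟨ ℚᵘ.*-cong (toℚᵘ-ℕ→ℚ m) (toℚᵘ-ℕ→ℚ n) ⟨
  ℚ.toℚᵘ (ℕ→ℚ m) ℚᵘ.* ℚ.toℚᵘ (ℕ→ℚ n)    ≃⟨ ℚ.toℚᵘ-homo-* (ℕ→ℚ m) (ℕ→ℚ n) ⟨
  ℚ.toℚᵘ (ℕ→ℚ m * ℕ→ℚ n)                ∎)
  where open ℚᵘ.≤-Reasoning

ℕ→ℚ-homo-^ : ∀ m s → ℕ→ℚ (m ℕ.^ s) ≡ ℕ→ℚ m ^ s
ℕ→ℚ-homo-^ m zero    = refl
ℕ→ℚ-homo-^ m (suc s) = trans (ℕ→ℚ-homo-* m (m ℕ.^ s)) (cong (ℕ→ℚ m *_) (ℕ→ℚ-homo-^ m s))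

^-pos : ∀ {q} s → 0ℚ < q → 0ℚ < q ^ s
^-pos zero _ = ℚ.positive⁻¹ 1ℚ
^-pos {q} (suc s) 0<q =
  ℚ.positive⁻¹ _ {{ℚ.pos*pos⇒pos q {{ℚ.positive 0<q}} (q ^ s) {{ℚ.positive (^-pos s 0<q)}}}}

^-monoˡ-< : ∀ {x y} s → 0ℚ ℚ.≤ x → x < y → x ^ suc s < y ^ suc s
^-monoˡ-< zero _ x<y = ℚ.*-monoˡ-<-pos 1ℚ x<y
^-monoˡ-< {x} {y} (suc s) 0≤x x<y = begin-strict
  x * x ^ suc s  ≤⟨ ℚ.*-monoˡ-≤-nonNeg x {{ℚ.nonNegative 0≤x}} (ℚ.<⇒≤ (^-monoˡ-< s 0≤x x<y)) ⟩
  x * y ^ suc s  <⟨ ℚ.*-monoˡ-<-pos (y ^ suc s) {{ℚ.positive 0<yˢ}} x<y ⟩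
  y * y ^ suc s  ∎
  where
  open ℚ.≤-Reasoning
  0<yˢ = ^-pos (suc s) (ℚ.≤-<-trans 0≤x x<y)

-- The contrapositive of strict monotonicity; it stands in for taking roots.
^-cancelˡ-≤ : ∀ {x y} s → 0ℚ ℚ.≤ y → x ^ suc s ℚ.≤ y ^ suc s → x ℚ.≤ y
^-cancelˡ-≤ s 0≤y xˢ≤yˢ = ℚ.≮⇒≥ λ y<x → ℚ.<-irrefl refl (ℚ.<-≤-trans (^-monoˡ-< s 0≤y y<x) xˢ≤yˢ)

-- The asymptotic bound.

-- The constant c₁ for every k, inverse to the 3 in n ≤ (3d)^(m+1).
⅓ : ℚ
⅓ = + 1 ℚ./ 3

-- n < 2 is exceptional, as f 1 k = 0.
error : ℕ → ℚ
error (suc (suc _)) = 0ℚ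
error _             = ℚ.- 1ℚ

error-tendsToZero : TendsToZero error
error-tendsToZero δ 0<δ = 2 , λ where
  zero ()
  (suc zero) (s≤s ())
  (suc (suc n)) _ → 0<δ

lower-bound : ∀ k .{{_ : NonZero k}} n →
              ℕ→ℚ (f n k) ≥ (1ℚ + error n) * ⅓ · n ^[1/ suc ⌈ k /2⌉ ]
-- For n < 2 the factor 1 + ε(n) is 0, so the claim is that f is nonnegative.
lower-bound k zero q _ _ =
  ℚ.≤-trans (ℚ.≤-reflexive (ℚ.*-zeroˡ q)) (ℕ→ℚ-mono-≤ {n = f 0 k} z≤n)
lower-bound k (suc zero) q _ _ =
  ℚ.≤-trans (ℚ.≤-reflexive (ℚ.*-zeroˡ q)) (ℕ→ℚ-mono-≤ {n = f 1 k} z≤n)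
lower-bound k n@(suc (suc _)) q _ q^s≤n = begin
  ⅓ * q                    ≤⟨ ℚ.*-monoˡ-≤-nonNeg ⅓ q≤3d ⟩
  ⅓ * ℕ→ℚ (3 ℕ.* fₙ)       ≡⟨ cong (⅓ *_) (ℕ→ℚ-homo-* 3 fₙ) ⟩
  ⅓ * (ℕ→ℚ 3 * ℕ→ℚ fₙ)     ≡⟨ ℚ.*-assoc ⅓ (ℕ→ℚ 3) (ℕ→ℚ fₙ) ⟨
  -- The product `⅓ * ℕ→ℚ 3` evaluates to `1ℚ`.
  1ℚ * ℕ→ℚ fₙ              ≡⟨ ℚ.*-identityˡ (ℕ→ℚ fₙ) ⟩
  ℕ→ℚ fₙ                   ∎
  where
  open ℚ.≤-Reasoning
  fₙ = f n k

  n≤[3d]^s : n ≤ (3 ℕ.* fₙ) ℕ.^ suc ⌈ k /2⌉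
  n≤[3d]^s = covering-bound-power k (s≤s (s≤s z≤n)) (proj₁ (f-isMinimum n k))

  q^s≤[3d]^s : q ^ suc ⌈ k /2⌉ ℚ.≤ ℕ→ℚ (3 ℕ.* fₙ) ^ suc ⌈ k /2⌉
  q^s≤[3d]^s = begin
    q ^ suc ⌈ k /2⌉                   ≤⟨ q^s≤n ⟩
    ℕ→ℚ n                             ≤⟨ ℕ→ℚ-mono-≤ n≤[3d]^s ⟩
    ℕ→ℚ ((3 ℕ.* fₙ) ℕ.^ suc ⌈ k /2⌉)  ≡⟨ ℕ→ℚ-homo-^ (3 ℕ.* fₙ) (suc ⌈ k /2⌉) ⟩
    ℕ→ℚ (3 ℕ.* fₙ) ^ suc ⌈ k /2⌉      ∎

  q≤3d : q ℚ.≤ ℕ→ℚ (3 ℕ.* fₙ)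
  q≤3d = ^-cancelˡ-≤ ⌈ k /2⌉ (ℕ→ℚ-mono-≤ {n = 3 ℕ.* fₙ} z≤n) q^s≤[3d]^s

theorem1 : ∀ (k : ℕ) .{{_ : NonZero k}} → 2 ≤ k →
    ∃[ c₁ ] (0ℚ < c₁ ×
    ∃[ ε ] (TendsToZero ε ×
    (∀ (n : ℕ) → ℕ→ℚ (f n k) ≥ (1ℚ + ε n) * c₁ · n ^[1/ suc ⌈ k /2⌉ ])))
theorem1 k _ = ⅓ , ℚ.positive⁻¹ ⅓ , error , error-tendsToZero , lower-bound k
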